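{- Let $A$ be a finite alphabet, $k$ an integer, and $u,x\in A^*$ words such that $|u|\ge k\ge |x|$. Then $$\binom{|u|-|x|}{k-|x|}_q\binom{u}{x}_q=\sum_{t\in A^k}\binom{u}{t}_q\binom{t}{x}_q,$$ where the first factor on the left-hand side is a Gaussian binomial coefficient of integers and the other coefficients are $q$-binomial coefficients of words.
   Context: $A^*$ is the free monoid of finite words over $A$ (with concatenation and empty word $\varepsilon$), $|w|$ is the length of a word $w$, and $A^k$ is the set of words of length $k$. The $q$-binomial coefficient $\binom{u}{v}_q\in\mathbb{N}[q]$ of two words $u,v\in A^*$ is defined recursively by $\binom{u}{\varepsilon}_q=1$, $\binom{\varepsilon}{v}_q=0$ if $v\neq\varepsilon$, and, for all $u,v\in A^*$ and letters $a,b\in A$, $\binom{ua}{vb}_q=q^{|vb|}\binom{u}{vb}_q+\delta_{a,b}\binom{u}{v}_q$, where $\delta_{a,b}$ is the Kronecker delta. The Gaussian binomial coefficient of integers $m\ge r\ge0$ is $\binom{m}{r}_q=\frac{(1-q^m)(1-q^{m-1})\cdots(1-q^{m-r+1})}{(1-q)(1-q^2)\cdots(1-q^r)}\in\mathbb{N}[q]$. -}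

module Defs where

open import Algebra.Bundles using (CommutativeSemigroup; Semiring; CommutativeSemiring; CommutativeRing)
import Algebra.Definitions.RawSemiring as RawSemiringDefs
import Algebra.Properties.Monoid.Sum as ProductProperties
import Algebra.Properties.Ring as RingProperties
import Algebra.Properties.Semiring.Exp as ExpProperties
import Algebra.Properties.CommutativeSemigroup as CommutativeSemigroupProperties
open import Algebra.Structures using (IsCommutativeMonoid)
open import Algebra.Structures.Biased using (isCommutativeSemiringˡ)
open import Data.Bool.Base using (if_then_else_)
open import Data.Fin.Base using (Fin; toℕ)
open import Data.Fin.Properties using (inj⇒≟; toℕ-inject₁; toℕ-fromℕ)
open import Data.Integer.Base as ℤ using ()
import Data.Integer.Properties as ℤₚ
open import Data.List.Base
  using (List; []; _∷_; _∷ʳ_; length; map; foldr; reverse; tabulate; cartesianProductWith)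
open import Data.List.Properties using (reverse-++; length-reverse; reverse-injective)
open import Data.Nat.Base as ℕ using (ℕ; zero; suc; _∸_; _≤_; z≤n; s≤s)
import Data.Nat.Properties as ℕₚ
open import Data.Product.Base using (∃; _,_)
open import Function.Bundles using (_↔_; Inverse)
open import Function.Properties.Inverse using (↔⇒↣)
open import Level using (Level)
open import Relation.Binary.Bundles using (Setoid)
open import Relation.Binary.PropositionalEquality as ≡ using (_≡_; _≢_)
import Relation.Binary.Reasoning.Setoid as SetoidReasoning
open import Relation.Nullary.Decidable.Core using (Dec; yes; no; does)
open import Relation.Nullary.Negation.Core using (contradiction)

private variable
  a : Level

-- The semiring R[q] of polynomials over R. A polynomial is the list of its
-- coefficients, constant term first; trailing zeros are allowed, so equality
-- is equality of all coefficients.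

module Polynomial {c ℓ} (R : CommutativeSemiring c ℓ) where

  private module R = CommutativeSemiring R
  open R using (Carrier; 0#; 1#)

  Poly : Set c
  Poly = List Carrier

  coeff : Poly → ℕ → Carrier
  coeff []      _       = 0#
  coeff (x ∷ p) zero    = x
  coeff (x ∷ p) (suc n) = coeff p n

  infix 4 _≋_
  record _≋_ (p p′ : Poly) : Set ℓ where
    constructor mk≋
    field at : ∀ n → coeff p n R.≈ coeff p′ n
  open _≋_ public

  infixl 6 _⊕_
  infixl 7 _⊗_

  _⊕_ : Poly → Poly → Poly
  []      ⊕ p′       = p′
  (x ∷ p) ⊕ []       = x ∷ p
  (x ∷ p) ⊕ (y ∷ p′) = x R.+ y ∷ p ⊕ p′

  scale : Carrier → Poly → Poly
  scale x = map (x R.*_)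

  _⊗_ : Poly → Poly → Poly
  []      ⊗ p′ = []
  (x ∷ p) ⊗ p′ = scale x p′ ⊕ (0# ∷ p ⊗ p′)

  𝟘 𝟙 q : Poly
  𝟘 = []
  𝟙 = 1# ∷ []
  q = 0# ∷ 1# ∷ []

  ≋-setoid : Setoid c ℓ
  ≋-setoid = record
    { Carrier       = Poly
    ; _≈_           = _≋_
    ; isEquivalence = record
      { refl  = mk≋ λ _ → R.refl
      ; sym   = λ e → mk≋ λ n → R.sym (at e n)
      ; trans = λ e f → mk≋ λ n → R.trans (at e n) (at f n)
      }
    }

  private
    module P = Setoid ≋-setoid
    module RR = SetoidReasoning R.setoid

  coeff-⊕ : ∀ p p′ n → coeff (p ⊕ p′) n R.≈ coeff p n R.+ coeff p′ n
  coeff-⊕ []      p′       n       = R.sym (R.+-identityˡ _)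
  coeff-⊕ (x ∷ p) []       n       = R.sym (R.+-identityʳ _)
  coeff-⊕ (x ∷ p) (y ∷ p′) zero    = R.refl
  coeff-⊕ (x ∷ p) (y ∷ p′) (suc n) = coeff-⊕ p p′ n

  coeff-scale : ∀ x p n → coeff (scale x p) n R.≈ x R.* coeff p n
  coeff-scale x []      n       = R.sym (R.zeroʳ x)
  coeff-scale x (y ∷ p) zero    = R.refl
  coeff-scale x (y ∷ p) (suc n) = coeff-scale x p n

  private
    ∷-cong : ∀ {x y p p′} → x R.≈ y → p ≋ p′ → x ∷ p ≋ y ∷ p′
    ∷-cong e f .at zero    = e
    ∷-cong e f .at (suc n) = at f n

    0∷[] : 0# ∷ [] ≋ 𝟘
    0∷[] .at zero    = R.refl
    0∷[] .at (suc n) = R.refl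

    ⊕-cong : ∀ {p p′ r r′} → p ≋ p′ → r ≋ r′ → p ⊕ r ≋ p′ ⊕ r′
    ⊕-cong {p} {p′} {r} {r′} e f .at n = begin
      coeff (p ⊕ r) n            ≈⟨ coeff-⊕ p r n ⟩
      coeff p n R.+ coeff r n    ≈⟨ R.+-cong (at e n) (at f n) ⟩
      coeff p′ n R.+ coeff r′ n  ≈⟨ coeff-⊕ p′ r′ n ⟨
      coeff (p′ ⊕ r′) n          ∎ where open RR

    ⊕-comm : ∀ p r → p ⊕ r ≋ r ⊕ p
    ⊕-comm p r .at n = begin
      coeff (p ⊕ r) n          ≈⟨ coeff-⊕ p r n ⟩
      coeff p n R.+ coeff r n  ≈⟨ R.+-comm _ _ ⟩
      coeff r n R.+ coeff p n  ≈⟨ coeff-⊕ r p n ⟨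
      coeff (r ⊕ p) n          ∎ where open RR

    ⊕-assoc : ∀ p r s → (p ⊕ r) ⊕ s ≋ p ⊕ (r ⊕ s)
    ⊕-assoc p r s .at n = begin
      coeff ((p ⊕ r) ⊕ s) n                      ≈⟨ coeff-⊕ (p ⊕ r) s n ⟩
      coeff (p ⊕ r) n R.+ coeff s n              ≈⟨ R.+-congʳ (coeff-⊕ p r n) ⟩
      (coeff p n R.+ coeff r n) R.+ coeff s n    ≈⟨ R.+-assoc _ _ _ ⟩
      coeff p n R.+ (coeff r n R.+ coeff s n)    ≈⟨ R.+-congˡ (coeff-⊕ r s n) ⟨
      coeff p n R.+ coeff (r ⊕ s) n              ≈⟨ coeff-⊕ p (r ⊕ s) n ⟨
      coeff (p ⊕ (r ⊕ s)) n                      ∎ where open RR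

    ⊕-identityʳ : ∀ p → p ⊕ 𝟘 ≋ p
    ⊕-identityʳ p = ⊕-comm p 𝟘

  ⊕-isCommutativeMonoid : IsCommutativeMonoid _≋_ _⊕_ 𝟘
  ⊕-isCommutativeMonoid = record
    { isMonoid = record
      { isSemigroup = record
        { isMagma = record { isEquivalence = P.isEquivalence ; ∙-cong = ⊕-cong }
        ; assoc   = ⊕-assoc
        }
      ; identity = (λ _ → P.refl) , ⊕-identityʳ
      }
    ; comm = ⊕-comm
    }

  private
    module PR = SetoidReasoning ≋-setoid

    ⊕-commutativeSemigroup : CommutativeSemigroup c ℓ
    ⊕-commutativeSemigroup = record
      { isCommutativeSemigroup = IsCommutativeMonoid.isCommutativeSemigroup ⊕-isCommutativeMonoid }

    open CommutativeSemigroupProperties ⊕-commutativeSemigroup using (interchange; x∙yz≈y∙xz)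

    scale-cong : ∀ {x y p p′} → x R.≈ y → p ≋ p′ → scale x p ≋ scale y p′
    scale-cong {x} {y} {p} {p′} e f .at n = begin
      coeff (scale x p) n   ≈⟨ coeff-scale x p n ⟩
      x R.* coeff p n       ≈⟨ R.*-cong e (at f n) ⟩
      y R.* coeff p′ n      ≈⟨ coeff-scale y p′ n ⟨
      coeff (scale y p′) n  ∎ where open RR

    scale-⊕ : ∀ x p r → scale x (p ⊕ r) ≋ scale x p ⊕ scale x r
    scale-⊕ x p r .at n = begin
      coeff (scale x (p ⊕ r)) n                      ≈⟨ coeff-scale x (p ⊕ r) n ⟩
      x R.* coeff (p ⊕ r) n                          ≈⟨ R.*-congˡ (coeff-⊕ p r n) ⟩
      x R.* (coeff p n R.+ coeff r n)                ≈⟨ R.distribˡ _ _ _ ⟩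
      x R.* coeff p n R.+ x R.* coeff r n            ≈⟨ R.+-cong (coeff-scale x p n) (coeff-scale x r n) ⟨
      coeff (scale x p) n R.+ coeff (scale x r) n    ≈⟨ coeff-⊕ (scale x p) (scale x r) n ⟨
      coeff (scale x p ⊕ scale x r) n                ∎ where open RR

    scale-scale : ∀ x y p → scale x (scale y p) ≋ scale (x R.* y) p
    scale-scale x y p .at n = begin
      coeff (scale x (scale y p)) n  ≈⟨ coeff-scale x (scale y p) n ⟩
      x R.* coeff (scale y p) n      ≈⟨ R.*-congˡ (coeff-scale y p n) ⟩
      x R.* (y R.* coeff p n)        ≈⟨ R.*-assoc _ _ _ ⟨
      (x R.* y) R.* coeff p n        ≈⟨ coeff-scale (x R.* y) p n ⟨
      coeff (scale (x R.* y) p) n    ∎ where open RR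

    scale-0 : ∀ p → scale 0# p ≋ 𝟘
    scale-0 p .at n = R.trans (coeff-scale 0# p n) (R.zeroˡ _)

    scale-1 : ∀ p → scale 1# p ≋ p
    scale-1 p .at n = R.trans (coeff-scale 1# p n) (R.*-identityˡ _)

    0∷-⊕ : ∀ p r → 0# ∷ (p ⊕ r) ≋ (0# ∷ p) ⊕ (0# ∷ r)
    0∷-⊕ p r = ∷-cong (R.sym (R.+-identityˡ 0#)) P.refl

    ⊗-congˡ : ∀ p {r r′} → r ≋ r′ → p ⊗ r ≋ p ⊗ r′
    ⊗-congˡ []      e = P.refl
    ⊗-congˡ (x ∷ p) e = ⊕-cong (scale-cong R.refl e) (∷-cong R.refl (⊗-congˡ p e))

    ⊗-zeroʳ : ∀ p → p ⊗ 𝟘 ≋ 𝟘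
    ⊗-zeroʳ []      = P.refl
    ⊗-zeroʳ (x ∷ p) = P.trans (∷-cong R.refl (⊗-zeroʳ p)) 0∷[]

    ⊗-∷ : ∀ p y r → p ⊗ (y ∷ r) ≋ scale y p ⊕ (0# ∷ p ⊗ r)
    ⊗-∷ []      y r = P.sym 0∷[]
    ⊗-∷ (x ∷ p) y r = ∷-cong (R.+-congʳ (R.*-comm x y)) (begin
      scale x r ⊕ p ⊗ (y ∷ r)                    ≈⟨ ⊕-cong P.refl (⊗-∷ p y r) ⟩
      scale x r ⊕ (scale y p ⊕ (0# ∷ p ⊗ r))     ≈⟨ x∙yz≈y∙xz (scale x r) (scale y p) (0# ∷ p ⊗ r) ⟩
      scale y p ⊕ (scale x r ⊕ (0# ∷ p ⊗ r))     ∎) where open PR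

    ⊗-comm : ∀ p r → p ⊗ r ≋ r ⊗ p
    ⊗-comm []      r = P.sym (⊗-zeroʳ r)
    ⊗-comm (x ∷ p) r = begin
      scale x r ⊕ (0# ∷ p ⊗ r)  ≈⟨ ⊕-cong P.refl (∷-cong R.refl (⊗-comm p r)) ⟩
      scale x r ⊕ (0# ∷ r ⊗ p)  ≈⟨ ⊗-∷ r x p ⟨
      r ⊗ (x ∷ p)               ∎ where open PR

    ⊗-cong : ∀ {p p′ r r′} → p ≋ p′ → r ≋ r′ → p ⊗ r ≋ p′ ⊗ r′
    ⊗-cong {p} {p′} {r} {r′} e f = begin
      p ⊗ r    ≈⟨ ⊗-congˡ p f ⟩
      p ⊗ r′   ≈⟨ ⊗-comm p r′ ⟩
      r′ ⊗ p   ≈⟨ ⊗-congˡ r′ e ⟩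
      r′ ⊗ p′  ≈⟨ ⊗-comm r′ p′ ⟩
      p′ ⊗ r′  ∎ where open PR

    ⊗-distribˡ : ∀ p r s → p ⊗ (r ⊕ s) ≋ p ⊗ r ⊕ p ⊗ s
    ⊗-distribˡ []      r s = P.refl
    ⊗-distribˡ (x ∷ p) r s = begin
      scale x (r ⊕ s) ⊕ (0# ∷ p ⊗ (r ⊕ s))
        ≈⟨ ⊕-cong (scale-⊕ x r s) (P.trans (∷-cong R.refl (⊗-distribˡ p r s)) (0∷-⊕ (p ⊗ r) (p ⊗ s))) ⟩
      (scale x r ⊕ scale x s) ⊕ ((0# ∷ p ⊗ r) ⊕ (0# ∷ p ⊗ s))
        ≈⟨ interchange (scale x r) (scale x s) (0# ∷ p ⊗ r) (0# ∷ p ⊗ s) ⟩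
      (x ∷ p) ⊗ r ⊕ (x ∷ p) ⊗ s ∎ where open PR

    ⊗-distribʳ : ∀ p r s → (r ⊕ s) ⊗ p ≋ r ⊗ p ⊕ s ⊗ p
    ⊗-distribʳ p r s = begin
      (r ⊕ s) ⊗ p    ≈⟨ ⊗-comm (r ⊕ s) p ⟩
      p ⊗ (r ⊕ s)    ≈⟨ ⊗-distribˡ p r s ⟩
      p ⊗ r ⊕ p ⊗ s  ≈⟨ ⊕-cong (⊗-comm p r) (⊗-comm p s) ⟩
      r ⊗ p ⊕ s ⊗ p  ∎ where open PR

    scale-⊗ : ∀ x p r → scale x p ⊗ r ≋ scale x (p ⊗ r)
    scale-⊗ x []      r = P.refl
    scale-⊗ x (y ∷ p) r = begin
      scale (x R.* y) r ⊕ (0# ∷ scale x p ⊗ r)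
        ≈⟨ ⊕-cong (P.sym (scale-scale x y r)) (∷-cong (R.sym (R.zeroʳ x)) (scale-⊗ x p r)) ⟩
      scale x (scale y r) ⊕ scale x (0# ∷ p ⊗ r)
        ≈⟨ scale-⊕ x (scale y r) (0# ∷ p ⊗ r) ⟨
      scale x (scale y r ⊕ (0# ∷ p ⊗ r)) ∎ where open PR

    ⊗-assoc : ∀ p r s → (p ⊗ r) ⊗ s ≋ p ⊗ (r ⊗ s)
    ⊗-assoc []      r s = P.refl
    ⊗-assoc (x ∷ p) r s = begin
      (scale x r ⊕ (0# ∷ p ⊗ r)) ⊗ s
        ≈⟨ ⊗-distribʳ s (scale x r) (0# ∷ p ⊗ r) ⟩
      scale x r ⊗ s ⊕ (scale 0# s ⊕ (0# ∷ (p ⊗ r) ⊗ s))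
        ≈⟨ ⊕-cong (scale-⊗ x r s) (⊕-cong (scale-0 s) (∷-cong R.refl (⊗-assoc p r s))) ⟩
      scale x (r ⊗ s) ⊕ (0# ∷ p ⊗ (r ⊗ s)) ∎ where open PR

    ⊗-identityˡ : ∀ p → 𝟙 ⊗ p ≋ p
    ⊗-identityˡ p = P.trans (⊕-cong (scale-1 p) 0∷[]) (⊕-identityʳ p)

    ⊗-isCommutativeMonoid : IsCommutativeMonoid _≋_ _⊗_ 𝟙
    ⊗-isCommutativeMonoid = record
      { isMonoid = record
        { isSemigroup = record
          { isMagma = record { isEquivalence = P.isEquivalence ; ∙-cong = ⊗-cong }
          ; assoc   = ⊗-assoc
          }
        ; identity = ⊗-identityˡ , λ p → P.trans (⊗-comm p 𝟙) (⊗-identityˡ p)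
        }
      ; comm = ⊗-comm
      }

  commutativeSemiring : CommutativeSemiring c ℓ
  commutativeSemiring = record
    { isCommutativeSemiring = isCommutativeSemiringˡ record
      { +-isCommutativeMonoid = ⊕-isCommutativeMonoid
      ; *-isCommutativeMonoid = ⊗-isCommutativeMonoid
      ; distribʳ              = ⊗-distribʳ
      ; zeroˡ                 = λ _ → P.refl
      }
    }

module Polyℕ = Polynomial ℕₚ.+-*-commutativeSemiring
module Polyℤ = Polynomial ℤₚ.+-*-commutativeSemiring

ℕ[q] : CommutativeSemiring _ _
ℕ[q] = Polyℕ.commutativeSemiring

ℤ[q] : CommutativeRing _ _
ℤ[q] = record
  { Carrier = Poly
  ; -_      = neg
  ; isCommutativeRing = record
    { isRing = record
      { +-isAbelianGroup = record
        { isGroup = record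
          { isMonoid = S.+-isMonoid
          ; inverse  = (λ p → S.trans (S.+-comm (neg p) p) (inverseʳ p)) , inverseʳ
          ; ⁻¹-cong  = neg-cong
          }
        ; comm = S.+-comm
        }
      ; *-cong     = S.*-cong
      ; *-assoc    = S.*-assoc
      ; *-identity = S.*-identity
      ; distrib    = S.distrib
      }
    ; *-comm = S.*-comm
    }
  }
  where
  open Polyℤ
  module S = CommutativeSemiring commutativeSemiring

  neg : Poly → Poly
  neg = map λ x → ℤ.- x

  coeff-neg : ∀ p n → coeff (neg p) n ≡ ℤ.- coeff p n
  coeff-neg []      n       = ≡.refl
  coeff-neg (x ∷ p) zero    = ≡.refl
  coeff-neg (x ∷ p) (suc n) = coeff-neg p n

  neg-cong : ∀ {p p′} → p ≋ p′ → neg p ≋ neg p′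
  neg-cong {p} {p′} e .at n =
    ≡.trans (coeff-neg p n) (≡.trans (≡.cong (λ x → ℤ.- x) (at e n)) (≡.sym (coeff-neg p′ n)))

  inverseʳ : ∀ p → p ⊕ neg p ≋ 𝟘
  inverseʳ []      .at n       = ≡.refl
  inverseʳ (x ∷ p) .at zero    = ℤₚ.+-inverseʳ x
  inverseʳ (x ∷ p) .at (suc n) = at (inverseʳ p) n

ι : Polyℕ.Poly → Polyℤ.Poly
ι = map (λ n → ℤ.+ n)

module QProducts {c ℓ} (R : CommutativeRing c ℓ) (q : CommutativeRing.Carrier R) where
  open CommutativeRing R hiding (zero)
  open RawSemiringDefs (Semiring.rawSemiring semiring) using (_^_; product)

  1-q^ : ℕ → Carrier
  1-q^ n = 1# - q ^ n

  numerator : ℕ → ℕ → Carrier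
  numerator m r = product {r} λ i → 1-q^ (m ∸ toℕ i)

  denominator : ℕ → Carrier
  denominator r = product {r} λ i → 1-q^ (suc (toℕ i))

  private
    open ExpProperties semiring using (^-homo-*)
    open ProductProperties *-monoid using (sum-init-last; sum-cong-≋)
    open RingProperties ring using (-‿distribʳ-*)
    open CommutativeSemigroupProperties *-commutativeSemigroup using (x∙yz≈y∙xz)
    open SetoidReasoning setoid

    numerator-∷ʳ : ∀ m r → numerator m (suc r) ≈ numerator m r * 1-q^ (m ∸ r)
    numerator-∷ʳ m r = trans (sum-init-last {r} λ i → 1-q^ (m ∸ toℕ i)) (*-cong
      (sum-cong-≋ {r} λ i → reflexive (≡.cong (λ j → 1-q^ (m ∸ j)) (toℕ-inject₁ i)))
      (reflexive (≡.cong (λ j → 1-q^ (m ∸ j)) (toℕ-fromℕ r))))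

    denominator-∷ʳ : ∀ r → denominator (suc r) ≈ denominator r * 1-q^ (suc r)
    denominator-∷ʳ r = trans (sum-init-last {r} λ i → 1-q^ (suc (toℕ i))) (*-cong
      (sum-cong-≋ {r} λ i → reflexive (≡.cong (λ j → 1-q^ (suc j)) (toℕ-inject₁ i)))
      (reflexive (≡.cong (λ j → 1-q^ (suc j)) (toℕ-fromℕ r))))

    telescope : ∀ a b → (1# - a) + a * (1# - b) ≈ 1# - a * b
    telescope a b = begin
      (1# - a) + a * (1# - b)    ≈⟨ +-congˡ (trans (distribˡ a 1# (- b))
                                      (+-cong (*-identityʳ a) (sym (-‿distribʳ-* a b)))) ⟩
      (1# - a) + (a - a * b)     ≈⟨ +-assoc 1# (- a) _ ⟩
      1# + (- a + (a - a * b))   ≈⟨ +-congˡ (+-assoc (- a) a _) ⟨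
      1# + ((- a + a) - a * b)   ≈⟨ +-congˡ (+-congʳ (-‿inverseˡ a)) ⟩
      1# + (0# - a * b)          ≈⟨ +-congˡ (+-identityˡ _) ⟩
      1# - a * b                 ∎

  numerator-> : ∀ {m r} → m ℕ.< r → numerator m r ≈ 0#
  numerator-> {zero}  {suc r} _         = trans (*-congʳ (-‿inverseʳ 1#)) (zeroˡ _)
  numerator-> {suc m} {suc r} (s≤s m<r) = trans (*-congˡ (numerator-> m<r)) (zeroʳ _)

  numerator-pascal : ∀ m r →
    numerator m r * 1-q^ (suc r) + q ^ suc r * numerator m (suc r) ≈ numerator (suc m) (suc r)
  numerator-pascal m r = begin
    n * 1-q^ (suc r) + Q * numerator m (suc r)   ≈⟨ +-congˡ (*-congˡ (numerator-∷ʳ m r)) ⟩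
    n * 1-q^ (suc r) + Q * (n * 1-q^ (m ∸ r))    ≈⟨ +-congˡ (x∙yz≈y∙xz Q n _) ⟩
    n * 1-q^ (suc r) + n * (Q * 1-q^ (m ∸ r))    ≈⟨ distribˡ n _ _ ⟨
    n * (1-q^ (suc r) + Q * 1-q^ (m ∸ r))        ≈⟨ *-congˡ (telescope Q (q ^ (m ∸ r))) ⟩
    n * (1# - Q * q ^ (m ∸ r))                   ≈⟨ *-congˡ (+-congˡ (-‿cong (^-homo-* q (suc r) (m ∸ r)))) ⟨
    n * 1-q^ (suc r ℕ.+ (m ∸ r))                 ≈⟨ exponent (r ℕₚ.≤? m) ⟩
    n * 1-q^ (suc m)                             ≈⟨ *-comm n _ ⟩
    1-q^ (suc m) * n                             ∎
    where
    n = numerator m r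
    Q = q ^ suc r
    exponent : Dec (r ≤ m) → n * 1-q^ (suc r ℕ.+ (m ∸ r)) ≈ n * 1-q^ (suc m)
    exponent (yes r≤m) = *-congˡ (reflexive (≡.cong (λ j → 1-q^ (suc j)) (ℕₚ.m+[n∸m]≡n r≤m)))
    exponent (no  r≰m) = trans (trans (*-congʳ n≈0) (zeroˡ _)) (sym (trans (*-congʳ n≈0) (zeroˡ _)))
      where n≈0 = numerator-> (ℕₚ.≰⇒> r≰m)

  quotient-pascal : ∀ m r {g h} →
    g * denominator r ≈ numerator m r → h * denominator (suc r) ≈ numerator m (suc r) →
    (g + q ^ suc r * h) * denominator (suc r) ≈ numerator (suc m) (suc r)
  quotient-pascal m r {g} {h} eg eh = begin
    (g + Q * h) * denominator (suc r)                            ≈⟨ distribʳ _ g (Q * h) ⟩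
    g * denominator (suc r) + Q * h * denominator (suc r)        ≈⟨ +-cong
      (trans (*-congˡ (denominator-∷ʳ r)) (sym (*-assoc g _ _))) (*-assoc Q h _) ⟩
    g * denominator r * 1-q^ (suc r) + Q * (h * denominator (suc r))
                                                                 ≈⟨ +-cong (*-congʳ eg) (*-congˡ eh) ⟩
    numerator m r * 1-q^ (suc r) + Q * numerator m (suc r)       ≈⟨ numerator-pascal m r ⟩
    numerator (suc m) (suc r)                                    ∎
    where Q = q ^ suc r

-- The Gaussian binomial coefficient is a quotient that lies in ℕ[q]. It is
-- given by its defining equation in ℤ[q], quotient * denominator = numerator,
-- which has at most one solution since ℤ[q] is a domain; a solution is
-- constructed in gaussianBinomial-exists.

IsGaussianBinomial : ℕ → ℕ → Polyℕ.Poly → Set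
IsGaussianBinomial m r g = ι g * denominator r ≈ numerator m r
  where
  open CommutativeRing ℤ[q] using (_*_; _≈_)
  open QProducts ℤ[q] Polyℤ.q using (numerator; denominator)

private module Pascal where
  module N = CommutativeSemiring ℕ[q]
  open RawSemiringDefs N.rawSemiring using () renaming (_^_ to _^ℕ_)

  pascal : ℕ → ℕ → Polyℕ.Poly
  pascal m       zero    = N.1#
  pascal zero    (suc r) = N.0#
  pascal (suc m) (suc r) = pascal m r N.+ Polyℕ.q ^ℕ suc r N.* pascal m (suc r)

  open CommutativeRing ℤ[q] hiding (zero)
  open RawSemiringDefs (Semiring.rawSemiring semiring) using (_^_)
  open QProducts ℤ[q] Polyℤ.q

  ι-+ : ∀ p r → ι (p N.+ r) ≡ ι p + ι r
  ι-+ []      r       = ≡.refl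
  ι-+ (x ∷ p) []      = ≡.refl
  ι-+ (x ∷ p) (y ∷ r) = ≡.cong₂ _∷_ ≡.refl (ι-+ p r)

  ι-scale : ∀ x p → ι (Polyℕ.scale x p) ≡ Polyℤ.scale (ℤ.+ x) (ι p)
  ι-scale x []      = ≡.refl
  ι-scale x (y ∷ p) = ≡.cong₂ _∷_ (ℤₚ.pos-* x y) (ι-scale x p)

  ι-* : ∀ p r → ι (p N.* r) ≡ ι p * ι r
  ι-* []      r = ≡.refl
  ι-* (x ∷ p) r = ≡.trans (ι-+ (Polyℕ.scale x r) (0 ∷ p N.* r))
    (≡.cong₂ (λ s t → s + (ℤ.+ 0 ∷ t)) (ι-scale x r) (ι-* p r))

  ι-q^ : ∀ n → ι (Polyℕ.q ^ℕ n) ≡ Polyℤ.q ^ n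
  ι-q^ zero    = ≡.refl
  ι-q^ (suc n) = ≡.trans (ι-* Polyℕ.q (Polyℕ.q ^ℕ n)) (≡.cong (Polyℤ.q *_) (ι-q^ n))

  pascal-isGaussianBinomial : ∀ m r → IsGaussianBinomial m r (pascal m r)
  pascal-isGaussianBinomial m       zero    = *-identityʳ 1#
  pascal-isGaussianBinomial zero    (suc r) = sym (numerator-> {zero} {suc r} (s≤s z≤n))
  pascal-isGaussianBinomial (suc m) (suc r) = ≡.subst (λ p → p * denominator (suc r) ≈ numerator (suc m) (suc r))
    (≡.sym (≡.trans (ι-+ g (Polyℕ.q ^ℕ suc r N.* h))
      (≡.cong (ι g +_) (≡.trans (ι-* (Polyℕ.q ^ℕ suc r) h) (≡.cong (_* ι h) (ι-q^ (suc r)))))))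
    (quotient-pascal m r {ι g} {ι h} (pascal-isGaussianBinomial m r) (pascal-isGaussianBinomial m (suc r)))
    where
    g = pascal m r
    h = pascal m (suc r)

gaussianBinomial-exists : ∀ m r → ∃ λ g → IsGaussianBinomial m r g
gaussianBinomial-exists m r = Pascal.pascal m r , Pascal.pascal-isGaussianBinomial m r

-- A finite alphabet is a type A with a bijection A ↔ Fin n.

module _ {A : Set a} {n : ℕ} (fin : A ↔ Fin n) where
  open CommutativeSemiring ℕ[q] hiding (zero)
  open RawSemiringDefs rawSemiring using (_^_)
  open Polyℕ using (q)

  letters : List A
  letters = tabulate (Inverse.from fin)

  words : ℕ → List (List A)
  words zero    = [] ∷ []
  words (suc k) = cartesianProductWith _∷ʳ_ (words k) letters

  ∑ : List (List A) → (List A → Carrier) → Carrier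
  ∑ ts f = foldr _+_ 0# (map f ts)

  δ : A → A → Carrier
  δ x y = if does (inj⇒≟ (↔⇒↣ fin) x y) then 1# else 0#

  -- The recursion consumes words from their last letter, hence the reversal;
  -- binom-ε, ε-binom and binom-∷ʳ are the defining equations.
  reversedBinom : List A → List A → Carrier
  reversedBinom u       []      = 1#
  reversedBinom []      (y ∷ v) = 0#
  reversedBinom (x ∷ u) (y ∷ v) =
    q ^ length (y ∷ v) * reversedBinom u (y ∷ v) + δ x y * reversedBinom u v

  binom : List A → List A → Carrier
  binom u v = reversedBinom (reverse u) (reverse v)

  binom-ε : ∀ u → binom u [] ≡ 1#
  binom-ε u = ≡.refl

  ε-binom : ∀ v → v ≢ [] → binom [] v ≡ 0#
  ε-binom v v≢[] with reverse v in eq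
  ... | []    = contradiction (reverse-injective eq) v≢[]
  ... | _ ∷ _ = ≡.refl

  binom-∷ʳ : ∀ u v x y → binom (u ∷ʳ x) (v ∷ʳ y) ≡
    q ^ length (v ∷ʳ y) * binom u (v ∷ʳ y) + δ x y * binom u v
  binom-∷ʳ u v x y
    rewrite ≡.sym (length-reverse (v ∷ʳ y)) | reverse-++ u (x ∷ []) | reverse-++ v (y ∷ []) = ≡.refl

{-# OPTIONS --safe #-}

-- Induction on u, for all k ≥ |x| without the bound k ≤ |u|. Expanding the
-- left factors of the sum S(u, x, k) (chain u x k below) by the last letter of ua and t, and then
-- the right factors by the last letter of t and xc, gives
--   S(ua, xc, k + 1) = q^(k+1) S(u, xc, k + 1) + q^|xc| S(u, xc, k) + δ(a, c) S(u, x, k),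
-- and the induction hypotheses combine by Pascal's rule for Gaussian binomials.
-- Both sides vanish when |u| < |x|. A Gaussian binomial is determined by its
-- defining equation because the denominator has constant term 1.
module Submission where

open import Algebra.Bundles using (CommutativeSemiring; CommutativeRing; Semiring)
import Algebra.Definitions.RawSemiring as RawSemiringDefs
import Algebra.Properties.AbelianGroup as AbelianGroupProperties
import Algebra.Properties.Ring as RingProperties
import Algebra.Properties.Semiring.Exp as ExpProperties
import Algebra.Solver.Ring.NaturalCoefficients.Default as SemiringSolver
open import Data.Bool.Base using (if_then_else_)
open import Data.Fin.Base using (Fin; zero; suc; toℕ)
open import Data.Fin.Properties using (inj⇒≟)
import Data.Integer.Base as ℤ
import Data.Integer.Properties as ℤₚ
open import Data.List.Base
  using (List; []; _∷_; _∷ʳ_; _++_; length; map; foldr; reverse; tabulate; cartesianProductWith)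
open import Data.List.Properties using (length-reverse; reverse-++)
open import Data.Nat.Base as ℕ using (ℕ; zero; suc; _∸_; _≤_; _<_; s≤s)
import Data.Nat.Properties as ℕₚ
open import Data.Product.Base using (proj₁; proj₂)
open import Function.Base using (_∘_)
open import Function.Bundles using (_↔_; Inverse)
open import Function.Properties.Inverse using (↔⇒↣)
open import Relation.Binary.PropositionalEquality as ≡ using (_≡_; _≢_)
import Relation.Binary.Reasoning.Setoid as SetoidReasoning
open import Relation.Nullary.Decidable using (yes; no; dec-true; dec-false)
open import Defs

-- Finite sums over lists in a commutative semiring.

module ListSum {c ℓ} (R : CommutativeSemiring c ℓ) where
  open CommutativeSemiring R hiding (zero)
  open SetoidReasoning setoid
  open SemiringSolver R using (solve; _:=_; _:+_; _:*_)

  sumOver : ∀ {b} {B : Set b} → List B → (B → Carrier) → Carrier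
  sumOver xs f = foldr _+_ 0# (map f xs)

  module _ {b} {B : Set b} where

    sumOver-cong : ∀ (xs : List B) {f h} → (∀ x → f x ≈ h x) → sumOver xs f ≈ sumOver xs h
    sumOver-cong []       e = refl
    sumOver-cong (x ∷ xs) e = +-cong (e x) (sumOver-cong xs e)

    sumOver-+ : ∀ (xs : List B) f h → sumOver xs (λ x → f x + h x) ≈ sumOver xs f + sumOver xs h
    sumOver-+ []       f h = sym (+-identityˡ 0#)
    sumOver-+ (x ∷ xs) f h = trans (+-congˡ (sumOver-+ xs f h))
      (solve 4 (λ a b c d → (a :+ b) :+ (c :+ d) := (a :+ c) :+ (b :+ d)) refl _ _ _ _)

    sumOver-*ˡ : ∀ (xs : List B) y f → sumOver xs (λ x → y * f x) ≈ y * sumOver xs f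
    sumOver-*ˡ []       y f = sym (zeroʳ y)
    sumOver-*ˡ (x ∷ xs) y f = trans (+-congˡ (sumOver-*ˡ xs y f)) (sym (distribˡ y _ _))

    sumOver-++ : ∀ (xs ys : List B) f → sumOver (xs ++ ys) f ≈ sumOver xs f + sumOver ys f
    sumOver-++ []       ys f = sym (+-identityˡ _)
    sumOver-++ (x ∷ xs) ys f = trans (+-congˡ (sumOver-++ xs ys f)) (sym (+-assoc _ _ _))

    sumOver-tabulate-0 : ∀ {n} (e : Fin n → B) f → (∀ i → f (e i) ≈ 0#) → sumOver (tabulate e) f ≈ 0#
    sumOver-tabulate-0 {zero}  e f f≈0 = refl
    sumOver-tabulate-0 {suc n} e f f≈0 =
      trans (+-cong (f≈0 zero) (sumOver-tabulate-0 (e ∘ suc) f (f≈0 ∘ suc))) (+-identityˡ 0#)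

    sumOver-tabulate-single : ∀ {n} (e : Fin n → B) f j →
      (∀ i → i ≢ j → f (e i) ≈ 0#) → sumOver (tabulate e) f ≈ f (e j)
    sumOver-tabulate-single e f zero f≈0 =
      trans (+-congˡ (sumOver-tabulate-0 (e ∘ suc) f λ i → f≈0 (suc i) λ ())) (+-identityʳ _)
    sumOver-tabulate-single e f (suc j) f≈0 = trans
      (+-cong (f≈0 zero λ ())
        (sumOver-tabulate-single (e ∘ suc) f j λ i i≢j → f≈0 (suc i) λ { ≡.refl → i≢j ≡.refl }))
      (+-identityˡ _)

  sumOver-map : ∀ {b b′} {B : Set b} {B′ : Set b′} (e : B → B′) xs f →
    sumOver (map e xs) f ≡ sumOver xs (f ∘ e)
  sumOver-map e []       f = ≡.refl
  sumOver-map e (x ∷ xs) f = ≡.cong (f (e x) +_) (sumOver-map e xs f)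

  module _ {b b′ b″} {B : Set b} {B′ : Set b′} {B″ : Set b″} where

    sumOver-cartesianProductWith : ∀ (e : B → B′ → B″) xs ys f →
      sumOver (cartesianProductWith e xs ys) f ≈ sumOver xs (λ x → sumOver ys (λ y → f (e x y)))
    sumOver-cartesianProductWith e []       ys f = refl
    sumOver-cartesianProductWith e (x ∷ xs) ys f =
      trans (sumOver-++ (map (e x) ys) (cartesianProductWith e xs ys) f)
        (+-cong (reflexive (sumOver-map (e x) ys f)) (sumOver-cartesianProductWith e xs ys f))

-- Words are read here from their last letter, as in reversedBinom, so that
-- extending a word on the right is consing.
module WordBinomial {c ℓ a} (R : CommutativeSemiring c ℓ) {A : Set a} where
  open CommutativeSemiring R hiding (zero)
  open RawSemiringDefs rawSemiring using (_^_)
  open ListSum R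
  open SetoidReasoning setoid
  open ExpProperties semiring using (^-homo-*)
  open SemiringSolver R using (solve; _:=_; _:+_; _:*_)

  -- Only the recurrences of the two binomials are assumed, so the induction is pure semiring
  -- reasoning and never unfolds polynomial arithmetic.
  module Recurrence
    (q : Carrier)
    (letters : List A) (δ : A → A → Carrier)
    (δ-sum : ∀ x (f : A → Carrier) → sumOver letters (λ y → δ x y * f y) ≈ f x)
    (G : ℕ → ℕ → Carrier)
    (G-0 : ∀ m → G m 0 ≈ 1#)
    (0-G : ∀ r → G 0 (suc r) ≈ 0#)
    (G-pascal : ∀ m r → G (suc m) (suc r) ≈ G m r + q ^ suc r * G m (suc r))
    (B : List A → List A → Carrier)
    (B-ε : ∀ u → B u [] ≈ 1#)
    (ε-B : ∀ y v → B [] (y ∷ v) ≈ 0#)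
    (B-∷ : ∀ x u y v → B (x ∷ u) (y ∷ v) ≈ q ^ suc (length v) * B u (y ∷ v) + δ x y * B u v)
    where

    -- Sums over words of fixed length.

    -- The head letter is summed innermost, so `B` can be expanded along it while the tail `t` stays
    -- fixed.
    wordSum : ℕ → (List A → Carrier) → Carrier
    wordSum zero    F = F []
    wordSum (suc k) F = wordSum k λ t → sumOver letters λ y → F (y ∷ t)

    -- The length of `t` is made available because the power of `q` in the recurrence of
    -- `B u (y ∷ t)` depends on it.
    wordSum-cong : ∀ k {F H} → (∀ t → length t ≡ k → F t ≈ H t) → wordSum k F ≈ wordSum k H
    wordSum-cong zero    e = e [] ≡.refl
    wordSum-cong (suc k) e = wordSum-cong k λ t l → sumOver-cong letters λ y → e (y ∷ t) (≡.cong suc l)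

    wordSum-+ : ∀ k F H → wordSum k (λ t → F t + H t) ≈ wordSum k F + wordSum k H
    wordSum-+ zero    F H = refl
    wordSum-+ (suc k) F H = trans (wordSum-cong k λ t _ → sumOver-+ letters _ _) (wordSum-+ k _ _)

    wordSum-*ˡ : ∀ k y F → wordSum k (λ t → y * F t) ≈ y * wordSum k F
    wordSum-*ˡ zero    y F = refl
    wordSum-*ˡ (suc k) y F = trans (wordSum-cong k λ t _ → sumOver-*ˡ letters y _) (wordSum-*ˡ k y _)

    wordSum-0 : ∀ k F → (∀ t → length t ≡ k → F t ≈ 0#) → wordSum k F ≈ 0#
    wordSum-0 k F F≈0 = begin
      wordSum k F                 ≈⟨ wordSum-cong k (λ t l → trans (F≈0 t l) (sym (zeroˡ (F t)))) ⟩
      wordSum k (λ t → 0# * F t)  ≈⟨ wordSum-*ˡ k 0# F ⟩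
      0# * wordSum k F            ≈⟨ zeroˡ _ ⟩
      0#                          ∎

    -- Both terms of the recurrence again pair a word with a longer one.
    B-< : ∀ u v → length u < length v → B u v ≈ 0#
    B-< []      (y ∷ v) _         = ε-B y v
    B-< (x ∷ u) (y ∷ v) (s≤s u<v) = begin
      B (x ∷ u) (y ∷ v)                              ≈⟨ B-∷ x u y v ⟩
      q ^ suc (length v) * B u (y ∷ v) + δ x y * B u v
        ≈⟨ +-cong (*-congˡ (B-< u (y ∷ v) (ℕₚ.m<n⇒m<1+n u<v))) (*-congˡ (B-< u v u<v)) ⟩
      q ^ suc (length v) * 0# + δ x y * 0#           ≈⟨ +-cong (zeroʳ _) (zeroʳ _) ⟩
      0# + 0#                                        ≈⟨ +-identityˡ 0# ⟩
      0#                                             ∎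

    -- Recurrences for the sum over intermediate words.

    chain : List A → List A → ℕ → Carrier
    chain u x k = wordSum k λ t → B u t * B t x

    chain-0 : ∀ u x k → k < length x → chain u x k ≈ 0#
    chain-0 u x k k<x = wordSum-0 k _ λ t l →
      trans (*-congˡ (B-< t x (≡.subst (_< length x) (≡.sym l) k<x))) (zeroʳ _)

    chain-ε : ∀ x k → chain [] x (suc k) ≈ 0#
    chain-ε x k = wordSum-0 (suc k) (λ t → B [] t * B t x)
      λ { (y ∷ t) _ → trans (*-congʳ (ε-B y t)) (zeroˡ (B (y ∷ t) x)) }

    -- Expanding `B (a ∷ u) (y ∷ t)` gives a multiple of the summand for `u` and a delta term;
    -- summing over `y`, the delta term survives only at `y = a`.
    chain-∷ : ∀ a u x k →
      chain (a ∷ u) x (suc k) ≈ q ^ suc k * chain u x (suc k) + wordSum k (λ t → B u t * B (a ∷ t) x)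
    chain-∷ a u x k = begin
      chain (a ∷ u) x (suc k)
        ≈⟨ wordSum-cong k inner ⟩
      wordSum k (λ t → q ^ suc k * sumOver letters (λ y → B u (y ∷ t) * B (y ∷ t) x) + B u t * B (a ∷ t) x)
        ≈⟨ wordSum-+ k _ _ ⟩
      wordSum k (λ t → q ^ suc k * sumOver letters (λ y → B u (y ∷ t) * B (y ∷ t) x))
        + wordSum k (λ t → B u t * B (a ∷ t) x)
        ≈⟨ +-congʳ (wordSum-*ˡ k _ _) ⟩
      q ^ suc k * chain u x (suc k) + wordSum k (λ t → B u t * B (a ∷ t) x) ∎
      where
      inner : ∀ t → length t ≡ k → sumOver letters (λ y → B (a ∷ u) (y ∷ t) * B (y ∷ t) x) ≈
        q ^ suc k * sumOver letters (λ y → B u (y ∷ t) * B (y ∷ t) x) + B u t * B (a ∷ t) x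
      -- Matching on the length equation turns `k` into `length t`, the form in which `B-∷` gives
      -- the exponent.
      inner t ≡.refl = begin
        sumOver letters (λ y → B (a ∷ u) (y ∷ t) * B (y ∷ t) x)
          ≈⟨ sumOver-cong letters (λ y → trans (*-congʳ (B-∷ a u y t))
               (solve 5 (λ Q b d e f → (Q :* b :+ d :* e) :* f := Q :* (b :* f) :+ d :* (e :* f)) refl _ _ _ _ _)) ⟩
        sumOver letters (λ y → q ^ suc (length t) * (B u (y ∷ t) * B (y ∷ t) x) + δ a y * (B u t * B (y ∷ t) x))
          ≈⟨ sumOver-+ letters _ _ ⟩
        sumOver letters (λ y → q ^ suc (length t) * (B u (y ∷ t) * B (y ∷ t) x))
          + sumOver letters (λ y → δ a y * (B u t * B (y ∷ t) x))
          ≈⟨ +-cong (sumOver-*ˡ letters _ _) (δ-sum a λ y → B u t * B (y ∷ t) x) ⟩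
        q ^ suc (length t) * sumOver letters (λ y → B u (y ∷ t) * B (y ∷ t) x) + B u t * B (a ∷ t) x ∎

    chain-∷-ε : ∀ a u k → chain (a ∷ u) [] (suc k) ≈ q ^ suc k * chain u [] (suc k) + chain u [] k
    chain-∷-ε a u k = trans (chain-∷ a u [] k)
      (+-congˡ (wordSum-cong k λ t _ → *-congˡ (trans (B-ε (a ∷ t)) (sym (B-ε t)))))

    -- In the expansion of `B (a ∷ t) (c ∷ x)` neither the power of `q` nor the delta depends on
    -- `t`, so both leave the sum.
    chain-∷-∷ : ∀ a u c x k → chain (a ∷ u) (c ∷ x) (suc k) ≈
      q ^ suc k * chain u (c ∷ x) (suc k) + (q ^ suc (length x) * chain u (c ∷ x) k + δ a c * chain u x k)
    chain-∷-∷ a u c x k = trans (chain-∷ a u (c ∷ x) k) (+-congˡ (begin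
      wordSum k (λ t → B u t * B (a ∷ t) (c ∷ x))
        ≈⟨ wordSum-cong k (λ t _ → trans (*-congˡ (B-∷ a t c x))
             (solve 5 (λ b Q e d f → b :* (Q :* e :+ d :* f) := Q :* (b :* e) :+ d :* (b :* f)) refl _ _ _ _ _)) ⟩
      wordSum k (λ t → q ^ suc (length x) * (B u t * B t (c ∷ x)) + δ a c * (B u t * B t x))
        ≈⟨ wordSum-+ k _ _ ⟩
      wordSum k (λ t → q ^ suc (length x) * (B u t * B t (c ∷ x))) + wordSum k (λ t → δ a c * (B u t * B t x))
        ≈⟨ +-cong (wordSum-*ˡ k _ _) (wordSum-*ˡ k _ _) ⟩
      q ^ suc (length x) * chain u (c ∷ x) k + δ a c * chain u x k ∎))

    -- The identity by induction on `u`.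

    -- If `x` is shorter than `u`, the upper index is a successor and Pascal's rule applies.
    -- Otherwise the subtraction is truncated, but then `c ∷ x` is longer than `u` and `B u (c ∷ x)`
    -- vanishes.
    G-pascal-B : ∀ u c x r → G (length u ∸ length x) (suc r) * B u (c ∷ x) ≈
      (G (length u ∸ suc (length x)) r + q ^ suc r * G (length u ∸ suc (length x)) (suc r)) * B u (c ∷ x)
    G-pascal-B u c x r with length x ℕₚ.<? length u
    ... | yes x<u = *-congʳ (trans (reflexive (≡.cong (λ m → G m (suc r)) (ℕₚ.+-∸-assoc 1 x<u)))
                      (G-pascal (length u ∸ suc (length x)) r))
    ... | no  x≮u = trans (trans (*-congˡ B≈0) (zeroʳ _)) (sym (trans (*-congˡ B≈0) (zeroʳ _)))
      where B≈0 = B-< u (c ∷ x) (ℕₚ.≰⇒> x≮u)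

    -- Here `k` is `length x + r`, so `r` is the lower index of the Gaussian binomial. The induction
    -- hypothesis for `u` is also used at the same `k` as for `a ∷ u`, which may exceed `length u`;
    -- hence `r` ranges freely.
    G-B≈chain : ∀ u x r → G (length u ∸ length x) r * B u x ≈ chain u x (length x ℕ.+ r)
    G-B≈chain u       []      zero    = *-cong (trans (G-0 (length u)) (sym (B-ε u))) (trans (B-ε u) (sym (B-ε [])))
    G-B≈chain []      []      (suc r) = trans (trans (*-congʳ (0-G r)) (zeroˡ _))
      (sym (chain-ε [] r))
    G-B≈chain []      (c ∷ x) r       = trans (trans (*-congˡ (ε-B c x)) (zeroʳ _))
      (sym (chain-ε (c ∷ x) (length x ℕ.+ r)))
    G-B≈chain (a ∷ u) []      (suc r) = begin
      G (suc m) (suc r) * B (a ∷ u) []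
        ≈⟨ *-cong (G-pascal m r) (trans (B-ε (a ∷ u)) (sym (B-ε u))) ⟩
      (G m r + q ^ suc r * G m (suc r)) * B u []
        ≈⟨ solve 4 (λ g Q h b → (g :+ Q :* h) :* b := Q :* (h :* b) :+ g :* b) refl _ _ _ _ ⟩
      q ^ suc r * (G m (suc r) * B u []) + G m r * B u []
        ≈⟨ +-cong (*-congˡ (G-B≈chain u [] (suc r))) (G-B≈chain u [] r) ⟩
      q ^ suc r * chain u [] (suc r) + chain u [] r
        ≈⟨ chain-∷-ε a u r ⟨
      chain (a ∷ u) [] (suc r) ∎
      where m = length u
    G-B≈chain (a ∷ u) (c ∷ x) r = begin
      G m r * B (a ∷ u) (c ∷ x)
        ≈⟨ *-congˡ (B-∷ a u c x) ⟩
      G m r * (Q * b + δ a c * B u x)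
        ≈⟨ solve 5 (λ g Q b d e → g :* (Q :* b :+ d :* e) := Q :* (g :* b) :+ d :* (g :* e)) refl _ _ _ _ _ ⟩
      Q * (G m r * b) + δ a c * (G m r * B u x)
        -- Dropping both last letters keeps the length difference `m`, so the delta term is an
        -- instance of the induction hypothesis. The pair `u`, `c ∷ x` has difference `m′`, and
        -- `split` first passes from `m` to `m′`.
        ≈⟨ +-cong (split r) (*-congˡ (G-B≈chain u x r)) ⟩
      (q ^ suc (l ℕ.+ r) * chain u (c ∷ x) (suc (l ℕ.+ r)) + Q * chain u (c ∷ x) (l ℕ.+ r))
        + δ a c * chain u x (l ℕ.+ r)
        ≈⟨ +-assoc _ _ _ ⟩
      q ^ suc (l ℕ.+ r) * chain u (c ∷ x) (suc (l ℕ.+ r))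
        + (Q * chain u (c ∷ x) (l ℕ.+ r) + δ a c * chain u x (l ℕ.+ r))
        ≈⟨ chain-∷-∷ a u c x (l ℕ.+ r) ⟨
      chain (a ∷ u) (c ∷ x) (suc (l ℕ.+ r)) ∎
      where
      l = length x
      m = length u ∸ l
      m′ = length u ∸ suc l
      Q = q ^ suc l
      b = B u (c ∷ x)

      split : ∀ r → Q * (G m r * b) ≈
        q ^ suc (l ℕ.+ r) * chain u (c ∷ x) (suc (l ℕ.+ r)) + Q * chain u (c ∷ x) (l ℕ.+ r)
      split zero = begin
        Q * (G m 0 * b)
          ≈⟨ *-cong (reflexive (≡.cong (λ i → q ^ suc i) (≡.sym (ℕₚ.+-identityʳ l))))
               (trans (*-congʳ (trans (G-0 m) (sym (G-0 m′)))) (G-B≈chain u (c ∷ x) 0)) ⟩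
        q ^ suc (l ℕ.+ 0) * chain u (c ∷ x) (suc (l ℕ.+ 0))
          ≈⟨ +-identityʳ _ ⟨
        q ^ suc (l ℕ.+ 0) * chain u (c ∷ x) (suc (l ℕ.+ 0)) + 0#
          -- For `r = 0` the Pascal expansion has one term only; the other chain sum runs over words
          -- of length `l`, too short to contain `c ∷ x`.
          ≈⟨ +-congˡ (trans (*-congˡ (chain-0 u (c ∷ x) (l ℕ.+ 0)
               (s≤s (ℕₚ.≤-reflexive (ℕₚ.+-identityʳ l))))) (zeroʳ Q)) ⟨
        q ^ suc (l ℕ.+ 0) * chain u (c ∷ x) (suc (l ℕ.+ 0)) + Q * chain u (c ∷ x) (l ℕ.+ 0) ∎
      split (suc r) = begin
        Q * (G m (suc r) * b)
          ≈⟨ *-congˡ (G-pascal-B u c x r) ⟩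
        Q * ((G m′ r + q ^ suc r * G m′ (suc r)) * b)
          ≈⟨ solve 5 (λ Q g P h b → Q :* ((g :+ P :* h) :* b) := (Q :* P) :* (h :* b) :+ Q :* (g :* b)) refl _ _ _ _ _ ⟩
        (Q * q ^ suc r) * (G m′ (suc r) * b) + Q * (G m′ r * b)
          -- The factor `Q` from the word recurrence and `q ^ suc r` from Pascal's rule multiply to
          -- `q` to the full length of the intermediate words.
          ≈⟨ +-cong (*-cong (sym (^-homo-* q (suc l) (suc r))) (G-B≈chain u (c ∷ x) (suc r)))
               (*-congˡ (trans (G-B≈chain u (c ∷ x) r)
                 (reflexive (≡.cong (chain u (c ∷ x)) (≡.sym (ℕₚ.+-suc l r)))))) ⟩
        q ^ suc (l ℕ.+ suc r) * chain u (c ∷ x) (suc (l ℕ.+ suc r)) + Q * chain u (c ∷ x) (l ℕ.+ suc r) ∎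

-- Constant terms and uniqueness of Gaussian binomials.

module ConstantTerm {c ℓ} (R : CommutativeSemiring c ℓ) where
  open Polynomial R
  open CommutativeSemiring R

  coeff-⊗-0 : ∀ p r → coeff (p ⊗ r) 0 ≈ coeff p 0 * coeff r 0
  coeff-⊗-0 []      r = sym (zeroˡ _)
  coeff-⊗-0 (x ∷ p) r = trans (coeff-⊕ (scale x r) (0# ∷ p ⊗ r) 0)
    (trans (+-identityʳ _) (coeff-scale x r 0))

module GaussianUniqueness where
  open CommutativeRing ℤ[q]
    using (_≈_; _-_; _+_; _*_; -_; 0#; 1#; refl; sym; trans; setoid; semiring; ring; +-abelianGroup;
           +-assoc; +-congˡ; -‿inverseˡ; +-identityʳ; distribʳ; +-cong; -‿inverseʳ)
  open RawSemiringDefs (Semiring.rawSemiring semiring) using (_^_)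
  open QProducts ℤ[q] Polyℤ.q
  open Polyℤ using (Poly; mk≋; at; coeff; coeff-⊕; coeff-scale; q)
  open ConstantTerm ℤₚ.+-*-commutativeSemiring

  -- Since `d` has constant term 1, the constant term of the product is `x`, so `x` is zero. The
  -- product is then `p * d` shifted by one degree, and the induction continues with `p`.
  ⊗-nonZeroDivisor : ∀ d p → coeff d 0 ≡ ℤ.1ℤ → p * d ≈ 0# → p ≈ 0#
  ⊗-nonZeroDivisor d []      d₀≡1 e = refl
  ⊗-nonZeroDivisor d (x ∷ p) d₀≡1 e = mk≋ λ { zero → x≡0 ; (suc n) → at (⊗-nonZeroDivisor d p d₀≡1 p*d≈0) n }
    where
    x≡0 : x ≡ ℤ.0ℤ
    x≡0 = ≡.trans (≡.sym (ℤₚ.*-identityʳ x)) (≡.trans (≡.cong (x ℤ.*_) (≡.sym d₀≡1))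
      (≡.trans (≡.sym (coeff-⊗-0 (x ∷ p) d)) (at e 0)))

    p*d≈0 : p * d ≈ 0#
    p*d≈0 = mk≋ λ n → ≡.trans (≡.sym (shift n)) (at e (suc n))
      where
      shift : ∀ n → coeff ((x ∷ p) * d) (suc n) ≡ coeff (p * d) n
      shift n rewrite coeff-⊕ (Polyℤ.scale x d) (ℤ.0ℤ ∷ p * d) (suc n) | coeff-scale x d (suc n) | x≡0 =
        ≡.trans (≡.cong (ℤ._+ coeff (p * d) n) (ℤₚ.*-zeroˡ (coeff d (suc n)))) (ℤₚ.+-identityˡ _)

  -- Negation enters only through the ring axioms: adding `q ^ suc n`, whose constant term is zero,
  -- leaves 1.
  coeff-1-q^suc-0 : ∀ n → coeff (1-q^ (suc n)) 0 ≡ ℤ.1ℤ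
  coeff-1-q^suc-0 n = begin
    coeff (1-q^ (suc n)) 0                                ≡⟨ ℤₚ.+-identityʳ _ ⟨
    coeff (1-q^ (suc n)) 0 ℤ.+ ℤ.0ℤ                       ≡⟨ ≡.cong (λ z → coeff (1-q^ (suc n)) 0 ℤ.+ z)
      (≡.trans (coeff-⊗-0 q (q ^ n)) (ℤₚ.*-zeroˡ (coeff (q ^ n) 0))) ⟨
    coeff (1-q^ (suc n)) 0 ℤ.+ coeff (q ^ suc n) 0        ≡⟨ coeff-⊕ (1-q^ (suc n)) (q ^ suc n) 0 ⟨
    coeff (1-q^ (suc n) + q ^ suc n) 0                    ≡⟨ at cancel 0 ⟩
    ℤ.1ℤ                                                  ∎
    where
    open ≡.≡-Reasoning
    cancel : 1-q^ (suc n) + q ^ suc n ≈ 1#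
    cancel = trans (+-assoc 1# (- (q ^ suc n)) (q ^ suc n))
      (trans (+-congˡ {1#} (-‿inverseˡ (q ^ suc n))) (+-identityʳ 1#))

  coeff-product-0 : ∀ {r} (f : Fin r → Poly) → (∀ i → coeff (f i) 0 ≡ ℤ.1ℤ) →
    coeff (RawSemiringDefs.product (Semiring.rawSemiring semiring) f) 0 ≡ ℤ.1ℤ
  coeff-product-0 {zero}  f f₀≡1 = ≡.refl
  coeff-product-0 {suc r} f f₀≡1 = ≡.trans (coeff-⊗-0 (f zero) _)
    (≡.cong₂ ℤ._*_ (f₀≡1 zero) (coeff-product-0 (f ∘ suc) (f₀≡1 ∘ suc)))

  coeff-denominator-0 : ∀ r → coeff (denominator r) 0 ≡ ℤ.1ℤ
  coeff-denominator-0 r = coeff-product-0 {r} (λ i → 1-q^ (suc (toℕ i))) λ i → coeff-1-q^suc-0 (toℕ i)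

  coeff-ι : ∀ p n → coeff (ι p) n ≡ ℤ.+ Polyℕ.coeff p n
  coeff-ι []      n       = ≡.refl
  coeff-ι (x ∷ p) zero    = ≡.refl
  coeff-ι (x ∷ p) (suc n) = coeff-ι p n

  ι-injective : ∀ {g h} → ι g ≈ ι h → g Polyℕ.≋ h
  ι-injective {g} {h} e = Polyℕ.mk≋ λ n →
    ℤₚ.+-injective (≡.trans (≡.sym (coeff-ι g n)) (≡.trans (at e n) (coeff-ι h n)))

  -- The denominator annihilates the difference of two solutions, which is therefore zero in `ℤ[q]`;
  -- injectivity of `ι` brings the equality back to `ℕ[q]`.
  isGaussianBinomial-unique : ∀ m r g h → IsGaussianBinomial m r g → IsGaussianBinomial m r h → g Polyℕ.≋ h
  isGaussianBinomial-unique m r g h eg eh = ι-injective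
    (x∙y⁻¹≈ε⇒x≈y (ι g) (ι h) (⊗-nonZeroDivisor d (ι g - ι h) (coeff-denominator-0 r) (begin
      (ι g - ι h) * d          ≈⟨ distribʳ d (ι g) (- ι h) ⟩
      ι g * d + (- ι h) * d    ≈⟨ +-cong (trans eg (sym eh)) (sym (-‿distribˡ-* (ι h) d)) ⟩
      ι h * d - ι h * d        ≈⟨ -‿inverseʳ (ι h * d) ⟩
      0#                       ∎)))
    where
    open SetoidReasoning setoid
    open AbelianGroupProperties +-abelianGroup using (x∙y⁻¹≈ε⇒x≈y)
    open RingProperties ring using (-‿distribˡ-*)
    d = denominator r

-- Specialisation to words over a finite alphabet.

module _ {a} {A : Set a} {n : ℕ} (fin : A ↔ Fin n) where
  open CommutativeSemiring ℕ[q] hiding (zero)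
  open ListSum ℕ[q]
  open Inverse fin using (from; to; strictlyInverseˡ; strictlyInverseʳ)

  -- The bijection lists every letter exactly once, so only the index `to x` contributes.
  δ-sum : ∀ x (f : A → Carrier) → sumOver (letters fin) (λ y → δ fin x y * f y) ≈ f x
  δ-sum x f = trans (sumOver-tabulate-single from (λ y → δ fin x y * f y) (to x) off) on
    where
    off : ∀ i → i ≢ to x → δ fin x (from i) * f (from i) ≈ 0#
    off i i≢x = *-congʳ {f (from i)} (reflexive (≡.cong (if_then 1# else 0#)
      (dec-false (inj⇒≟ (↔⇒↣ fin) x (from i))
        λ x≡y → i≢x (≡.sym (≡.trans (≡.cong to x≡y) (strictlyInverseˡ i))))))

    on : δ fin x (from (to x)) * f (from (to x)) ≈ f x
    on rewrite strictlyInverseʳ x = trans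
      (*-congʳ {f x} (reflexive (≡.cong (if_then 1# else 0#) (dec-true (inj⇒≟ (↔⇒↣ fin) x x) ≡.refl))))
      (*-identityˡ (f x))

  gaussianBinomial : ℕ → ℕ → Carrier
  gaussianBinomial m r = proj₁ (gaussianBinomial-exists m r)

  -- The constructed Gaussian binomial and `reversedBinom` are both defined by the required
  -- recurrences, which therefore hold by `refl`.
  open WordBinomial.Recurrence ℕ[q] Polyℕ.q (letters fin) (δ fin) δ-sum
    gaussianBinomial (λ _ → refl) (λ _ → refl) (λ _ _ → refl)
    (reversedBinom fin) (λ _ → refl) (λ _ _ → refl) (λ _ _ _ _ → refl)

  -- `words` appends letters on the right while `wordSum` conses them; `reverse` exchanges the two.
  ∑-words : ∀ k F → ∑ fin (words fin k) (F ∘ reverse) ≈ wordSum k F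
  ∑-words zero    F = +-identityʳ (F [])
  ∑-words (suc k) F = begin
    ∑ fin (words fin (suc k)) (F ∘ reverse)
      ≈⟨ sumOver-cartesianProductWith _∷ʳ_ (words fin k) (letters fin) (F ∘ reverse) ⟩
    sumOver (words fin k) (λ t → sumOver (letters fin) λ y → F (reverse (t ∷ʳ y)))
      ≈⟨ sumOver-cong (words fin k) (λ t → sumOver-cong (letters fin) λ y →
           reflexive (≡.cong F (reverse-++ t (y ∷ [])))) ⟩
    sumOver (words fin k) (λ t → sumOver (letters fin) λ y → F (y ∷ reverse t))
      ≈⟨ ∑-words k (λ t → sumOver (letters fin) λ y → F (y ∷ t)) ⟩
    wordSum (suc k) F ∎
    where open SetoidReasoning setoid

  gaussianBinomial*binom : ∀ u x r → gaussianBinomial (length u ∸ length x) r * binom fin u x ≈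
    ∑ fin (words fin (length x ℕ.+ r)) (λ t → binom fin u t * binom fin t x)
  gaussianBinomial*binom u x r = ≡.subst₂
    (λ m l → gaussianBinomial (m ∸ l) r * binom fin u x ≈
      ∑ fin (words fin (l ℕ.+ r)) (λ t → binom fin u t * binom fin t x))
    (length-reverse u) (length-reverse x)
    (trans (G-B≈chain (reverse u) (reverse x) r) (sym (∑-words (length (reverse x) ℕ.+ r) _)))

theorem4p1 : ∀ {a} {A : Set a} {n : ℕ} (fin : A ↔ Fin n) (k : ℕ) (u x : List A) →
    k ≤ length u → length x ≤ k →
    let open CommutativeSemiring ℕ[q] in
    (g : Carrier) → IsGaussianBinomial (length u ∸ length x) (k ∸ length x) g →
    g * binom fin u x ≈ ∑ fin (words fin k) (λ t → binom fin u t * binom fin t x)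
theorem4p1 fin k u x _ x≤k g isGaussian = begin
  g * binom fin u x
    -- The given `g` is any solution of the defining equation; uniqueness replaces it by the one
    -- that satisfies Pascal's rule by construction.
    ≈⟨ *-congʳ {binom fin u x} (isGaussianBinomial-unique m r g G isGaussian isG) ⟩
  G * binom fin u x
    ≈⟨ gaussianBinomial*binom fin u x r ⟩
  ∑ fin (words fin (length x ℕ.+ r)) (λ t → binom fin u t * binom fin t x)
    ≡⟨ ≡.cong (λ j → ∑ fin (words fin j) (λ t → binom fin u t * binom fin t x)) (ℕₚ.m+[n∸m]≡n x≤k) ⟩
  ∑ fin (words fin k) (λ t → binom fin u t * binom fin t x) ∎
  where
  open CommutativeSemiring ℕ[q] using (_*_; *-congʳ; setoid)
  open SetoidReasoning setoid
  open GaussianUniqueness using (isGaussianBinomial-unique)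
  m = length u ∸ length x
  r = k ∸ length x
  G = proj₁ (gaussianBinomial-exists m r)
  isG = proj₂ (gaussianBinomial-exists m r)
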